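{- $\tilde{r}(C_4,P_6)=11$, where $\tilde{r}(G,H)$ denotes the online size Ramsey number of the graphs $G$ and $H$, $C_4$ is the cycle on $4$ vertices, and $P_6$ is the path on $6$ vertices (with $5$ edges). That is, in the Builder–Painter game on the edge set of the infinite clique $K_{\mathbb{N}}$, Builder has a strategy guaranteeing that after at most $11$ rounds there is a red copy of $C_4$ or a blue copy of $P_6$, and Builder has no strategy guaranteeing this after at most $10$ rounds.
   Context: Let $G$ and $H$ be fixed finite graphs. The $\tilde{R}(G,H)$-game is played by two players, Builder and Painter, on the edge set of the infinite clique $K_{\mathbb{N}}$ (the complete graph with vertex set $\mathbb{N}$). Initially no edge is chosen or colored. In each round Builder chooses an edge of $K_{\mathbb{N}}$ (not chosen before), and Painter immediately colors it red or blue; both players see all previous choices and colors. Builder wins as soon as the colored edges contain a red copy of $G$ (a subgraph isomorphic to $G$, not necessarily induced, all of whose edges are red) or a blue copy of $H$ (a subgraph isomorphic to $H$, not necessarily induced, all of whose edges are blue). Builder wants to win in as few rounds as possible, and Painter wants to delay this for as many rounds as possible. The online size Ramsey number $\tilde{r}(G,H)$ is the minimum number of rounds within which Builder can win, assuming both players play optimally; i.e. the least $t$ such that Builder has a strategy which, against every play of Painter, produces a red copy of $G$ or a blue copy of $H$ after at most $t$ rounds. Here $C_k$ denotes the cycle on $k$ vertices and $P_k$ denotes the path on $k$ vertices. -}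

module Defs where

open import Data.Empty using (⊥)
open import Data.Fin.Base using (Fin; toℕ)
open import Data.List.Base using (List; []; _∷_; map)
open import Data.List.Membership.Propositional using (_∈_; _∉_)
open import Data.Nat.Base using (ℕ; zero; suc; _≤_; _<_; s≤s)
open import Data.Nat.Properties using (_≤?_; 1+n≢n)
open import Data.Product.Base using (Σ-syntax; ∃-syntax; _×_; _,_; proj₁)
open import Data.Sum.Base using (_⊎_; inj₁; inj₂; [_,_]; swap)
open import Function.Bundles using (_↣_; Injection)
open import Level using (0ℓ)
open import Relation.Binary.Core using (Rel)
open import Relation.Binary.Definitions using (Symmetric)
open import Relation.Binary.PropositionalEquality using (_≡_; refl; sym; trans; cong)
open import Relation.Nullary using (¬_)
open import Relation.Nullary.Decidable using (True; toWitness)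

-- Finite simple graphs.

record Graph : Set₁ where
  field
    order      : ℕ
    Adj        : Rel (Fin order) 0ℓ
    adj-sym    : Symmetric Adj
    adj-irrefl : ∀ {i} → ¬ Adj i i

PathStep : ∀ {k} → Rel (Fin k) 0ℓ
PathStep i j = suc (toℕ i) ≡ toℕ j

path : ℕ → Graph
path k = record
  { order      = k
  ; Adj        = λ i j → PathStep i j ⊎ PathStep j i
  ; adj-sym    = swap
  ; adj-irrefl = [ 1+n≢n , 1+n≢n ]
  }

-- The second summand is the closing edge from the last vertex to the first.
CycleStep : ∀ {k} → Rel (Fin k) 0ℓ
CycleStep {k} i j = PathStep i j ⊎ (suc (toℕ i) ≡ k × toℕ j ≡ 0)

cycleStep-irrefl : ∀ {k} → 3 ≤ k → (i : Fin k) → ¬ CycleStep i i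
cycleStep-irrefl 3≤k i (inj₁ eq) = 1+n≢n eq
cycleStep-irrefl 3≤k i (inj₂ (last , first)) =
  absurd 3≤k (trans (sym last) (cong suc first))
  where
  absurd : ∀ {k} → 3 ≤ k → k ≡ 1 → ⊥
  absurd (s≤s ()) refl

cycle : (k : ℕ) {3≤k : True (3 ≤? k)} → Graph
cycle k {3≤k} = record
  { order      = k
  ; Adj        = λ i j → CycleStep i j ⊎ CycleStep j i
  ; adj-sym    = swap
  ; adj-irrefl = λ {i} → [ irrefl i , irrefl i ]
  }
  where
  irrefl : (i : Fin k) → ¬ CycleStep i i
  irrefl = cycleStep-irrefl (toWitness 3≤k)

-- An edge of K_ℕ is an unordered pair of distinct vertices, represented by
-- its increasing enumeration, so that _≡_ is equality of edges.
record Edge : Set where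
  constructor edge
  field
    lo hi  : ℕ
    .lo<hi : lo < hi

open Edge public

Joins : Edge → ℕ → ℕ → Set
Joins e u v = (lo e ≡ u × hi e ≡ v) ⊎ (lo e ≡ v × hi e ≡ u)

data Colour : Set where
  red blue : Colour

-- The rounds played so far, most recent first.
History : Set
History = List (Edge × Colour)

Fresh : History → Edge → Set
Fresh h e = e ∉ map proj₁ h

HasEdge : Colour → History → ℕ → ℕ → Set
HasEdge c h u v = ∃[ e ] (e , c) ∈ h × Joins e u v

-- A monochromatic, not necessarily induced, copy of G.
Copy : Colour → Graph → History → Set
Copy c G h =
  Σ[ f ∈ Fin order ↣ ℕ ]
    (∀ {i j} → Adj i j → HasEdge c h (Injection.to f i) (Injection.to f j))
  where open Graph G

Won : Graph → Graph → History → Set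
Won G H h = Copy red G h ⊎ Copy blue H h

-- Since K_ℕ is infinite, a legal move exists after every history, so asking
-- for one even after Builder has won is no restriction.
BuilderStrategy : Set
BuilderStrategy = (h : History) → Σ[ e ∈ Edge ] Fresh h e

PainterStrategy : Set
PainterStrategy = History → Edge → Colour

play : BuilderStrategy → PainterStrategy → ℕ → History
play σ π zero    = []
play σ π (suc t) = (e , π h e) ∷ h
  where
  h = play σ π t
  e = proj₁ (σ h)

WinsWithin : Graph → Graph → ℕ → BuilderStrategy → Set
WinsWithin G H t σ =
  (π : PainterStrategy) → ∃[ s ] s ≤ t × Won G H (play σ π s)

BuilderCanWinWithin : Graph → Graph → ℕ → Set
BuilderCanWinWithin G H t = Σ[ σ ∈ BuilderStrategy ] WinsWithin G H t σ

-- r̃⟨ G , H ⟩≡ r says that r is the least number of rounds within which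
-- Builder can win; a relation, as finding the least such number is not
-- constructively a total function of arbitrary G and H.
r̃⟨_,_⟩≡_ : Graph → Graph → ℕ → Set
r̃⟨ G , H ⟩≡ r =
  BuilderCanWinWithin G H r × (∀ t → BuilderCanWinWithin G H t → r ≤ t)

{-# OPTIONS --safe #-}

-- Lower bound: Painter paints an edge red unless that closes a red C₄.  Then each
-- blue edge joins two vertices that are also joined by a red walk of length three.
-- A blue P₆ on v₀ … v₅ thus needs a red graph connecting these six vertices, with
-- at least five edges.  Five do not suffice: they would form a tree on v₀ … v₅,
-- two-coloured by the parity of the index since walks of length three change the
-- colour, and the only edges between the colour classes that are not on the blue
-- path are v₀v₃, v₀v₅, v₁v₄ and v₂v₅, which is too few.
--
-- Upper bound: an explicit decision tree of depth 11 for Builder, found by computer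
-- search and checked by evaluation.

module Submission where

open import Defs

open import Data.Bool.Base using (Bool; true; not; _xor_)
import Data.Bool.Properties as Bool
open import Data.Bool.Properties using (not-¬; not-distribʳ-xor; not-involutive; ¬-not)
open import Data.Empty using (⊥; ⊥-elim; ⊥-elim-irr)
open import Data.Fin.Base using (Fin; zero; suc; inject₁; toℕ)
open import Data.Fin using (#_)
open import Data.Fin.Induction using (<-weakInduction)
import Data.Fin.Properties as Fin
open import Data.List.Base using (List; []; _∷_; map; filter; length; tabulate)
open import Data.List.Extrema.Nat using (max; xs≤max)
open import Data.List.Membership.Propositional using (_∈_; find; lose)
open import Data.List.Membership.Propositional.Properties
  using (∈-map⁺; ∈-filter⁺; ∈-tabulate⁻)
import Data.List.Membership.DecPropositional as DecMembership
open import Data.List.Properties using (filter-accept; filter-all; filter-reject)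
open import Data.List.Relation.Unary.All as All using (All; []; _∷_)
import Data.List.Relation.Unary.All.Properties as All
open import Data.List.Relation.Unary.AllPairs using ([]; _∷_)
open import Data.List.Relation.Unary.Any using (Any; here; there; any?)
open import Data.List.Relation.Unary.Unique.Propositional using (Unique)
import Data.List.Relation.Unary.Unique.Propositional.Properties as Unique
open import Data.Nat.Base using (ℕ; zero; suc; _+_; _⊔_; _≤_; _<_; z≤n; s≤s; s≤s⁻¹; z<s)
open import Data.Nat.Properties
open import Data.Product.Base using (Σ-syntax; ∃-syntax; _×_; _,_; proj₁; proj₂)
open import Data.Sum.Base using (_⊎_; inj₁; inj₂; swap)
open import Data.Unit.Base using (tt)
open import Data.Vec.Base using (Vec; []; _∷_; lookup)
open import Function.Base using (_∘_; id)
open import Function.Bundles using (_↣_; mk↣; module Injection)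
open import Level using (0ℓ)
open import Relation.Binary.Core using (Rel)
open import Relation.Binary.Definitions using (Decidable; DecidableEquality; Symmetric)
open import Relation.Binary.PropositionalEquality
  using (_≡_; _≢_; refl; sym; trans; cong; subst)
open import Relation.Nullary
open import Relation.Nullary.Decidable using (True; toWitness; _→-dec_; dec-true; dec-false)

private
  variable
    c : Colour
    e e′ : Edge
    E : List Edge
    G H : Graph
    h : History
    r u v w x : ℕ

-- Edges, adjacency and red walks in a history.

lo≢hi : ∀ e → lo e ≢ hi e
lo≢hi (edge _ _ lo<lo) refl = ⊥-elim-irr (n≮n _ lo<lo)

_≟ᵉ_ : DecidableEquality Edge
edge u v _ ≟ᵉ edge w x _ =
  map′ (λ { (refl , refl) → refl }) (λ { refl → refl , refl }) (u ≟ w ×-dec v ≟ x)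

_≟ᶜ_ : DecidableEquality Colour
red  ≟ᶜ red  = yes refl
red  ≟ᶜ blue = no λ ()
blue ≟ᶜ red  = no λ ()
blue ≟ᶜ blue = yes refl

Joins? : ∀ e u v → Dec (Joins e u v)
Joins? e u v = (lo e ≟ u ×-dec hi e ≟ v) ⊎-dec (lo e ≟ v ×-dec hi e ≟ u)

Joins-irrefl : ¬ Joins e u u
Joins-irrefl {e} (inj₁ (refl , hi≡lo)) = lo≢hi e (sym hi≡lo)
Joins-irrefl {e} (inj₂ (refl , hi≡lo)) = lo≢hi e (sym hi≡lo)

Joins-unique : Joins e u v → Joins e w x → (u ≡ w × v ≡ x) ⊎ (u ≡ x × v ≡ w)
Joins-unique (inj₁ (refl , refl)) (inj₁ (refl , refl)) = inj₁ (refl , refl)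
Joins-unique (inj₁ (refl , refl)) (inj₂ (refl , refl)) = inj₂ (refl , refl)
Joins-unique (inj₂ (refl , refl)) (inj₁ (refl , refl)) = inj₂ (refl , refl)
Joins-unique (inj₂ (refl , refl)) (inj₂ (refl , refl)) = inj₁ (refl , refl)

-- Ends are stored in increasing order with an irrelevant proof: equal orientations give `refl`, and
-- opposite ones would require both `u < v` and `v < u`.
Joins-injective : Joins e u v → Joins e′ u v → e ≡ e′
Joins-injective (inj₁ (refl , refl)) (inj₁ (refl , refl)) = refl
Joins-injective (inj₂ (refl , refl)) (inj₂ (refl , refl)) = refl
Joins-injective {e = edge _ _ lt} {e′ = edge _ _ gt} (inj₁ (refl , refl)) (inj₂ (refl , refl)) =
  ⊥-elim-irr (<-asym lt gt)
Joins-injective {e = edge _ _ lt} {e′ = edge _ _ gt} (inj₂ (refl , refl)) (inj₁ (refl , refl)) =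
  ⊥-elim-irr (<-asym lt gt)

HasEdge? : ∀ c h u v → Dec (HasEdge c h u v)
HasEdge? c h u v = map′ from to (any? match? h)
  where
  Match : Edge × Colour → Set
  Match (e , c′) = c′ ≡ c × Joins e u v

  match? : ∀ m → Dec (Match m)
  match? (e , c′) = c′ ≟ᶜ c ×-dec Joins? e u v

  from : Any Match h → HasEdge c h u v
  from any with find any
  ... | (e , _) , e∈h , refl , j = e , e∈h , j

  to : HasEdge c h u v → Any Match h
  to (e , e∈h , j) = lose e∈h (refl , j)

HasEdge-sym : HasEdge c h u v → HasEdge c h v u
HasEdge-sym (e , e∈h , j) = e , e∈h , swap j

HasEdge-irrefl : ¬ HasEdge c h u u
HasEdge-irrefl (e , _ , j) = Joins-irrefl {e} j

HasEdge-there : ∀ {m} → HasEdge c h u v → HasEdge c (m ∷ h) u v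
HasEdge-there (e , e∈h , j) = e , there e∈h , j

HasEdge-here⁻ : HasEdge c ((e , c) ∷ h) u v → Joins e u v ⊎ HasEdge c h u v
HasEdge-here⁻ (_ , here refl , j) = inj₁ j
HasEdge-here⁻ (_ , there e∈h , j) = inj₂ (_ , e∈h , j)

-- For ends that are not joined in red this says that they are joined by a red
-- path with three edges, so that colouring uv red would close a red C₄.
RedWalk : History → Rel ℕ 0ℓ
RedWalk h u v =
  ∃[ w ] ∃[ x ] HasEdge red h u w × HasEdge red h w x × HasEdge red h x v

RedWalk-sym : RedWalk h u v → RedWalk h v u
RedWalk-sym (w , x , uw , wx , xv) =
  x , w , HasEdge-sym xv , HasEdge-sym wx , HasEdge-sym uw

RedWalk-there : ∀ {m} → RedWalk h u v → RedWalk (m ∷ h) u v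
RedWalk-there (w , x , uw , wx , xv) =
  w , x , HasEdge-there uw , HasEdge-there wx , HasEdge-there xv

-- The inner vertices `w` and `x` range over all of ℕ, but the middle edge of the walk lies in `h`.
-- Hence a search through `h`, trying both orientations of each red edge, suffices.
RedWalk? : ∀ h u v → Dec (RedWalk h u v)
RedWalk? h u v = map′ from to (any? via? h)
  where
  Via : Edge × Colour → Set
  Via (e , c) = c ≡ red ×
    (HasEdge red h u (lo e) × HasEdge red h (hi e) v ⊎
     HasEdge red h u (hi e) × HasEdge red h (lo e) v)

  via? : ∀ m → Dec (Via m)
  via? (e , c) = c ≟ᶜ red ×-dec
    ((HasEdge? red h u (lo e) ×-dec HasEdge? red h (hi e) v) ⊎-dec
     (HasEdge? red h u (hi e) ×-dec HasEdge? red h (lo e) v))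

  from : Any Via h → RedWalk h u v
  from any with find any
  ... | (e , _) , e∈h , refl , inj₁ (uw , xv) =
    lo e , hi e , uw , (e , e∈h , inj₁ (refl , refl)) , xv
  ... | (e , _) , e∈h , refl , inj₂ (uw , xv) =
    hi e , lo e , uw , (e , e∈h , inj₂ (refl , refl)) , xv

  to : RedWalk h u v → Any Via h
  to (_ , _ , uw , (e , e∈h , inj₁ (refl , refl)) , xv) = lose e∈h (refl , inj₁ (uw , xv))
  to (_ , _ , uw , (e , e∈h , inj₂ (refl , refl)) , xv) = lose e∈h (refl , inj₂ (uw , xv))

-- The greedy Painter.

greedy : PainterStrategy
greedy h e with RedWalk? h (lo e) (hi e)
... | yes _ = blue
... | no  _ = red

-- Each colour is justified by the history before its own round. The properties of greedy play
-- follow by induction on this invariant, without reference to Builder's strategy.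
data Greedy : History → Set where
  []        : Greedy []
  paintRed  : Fresh h e → ¬ RedWalk h (lo e) (hi e) → Greedy h → Greedy ((e , red) ∷ h)
  paintBlue : Fresh h e → RedWalk h (lo e) (hi e) → Greedy h → Greedy ((e , blue) ∷ h)

paint-greedy : Fresh h e → Greedy h → Greedy ((e , greedy h e) ∷ h)
paint-greedy {h} {e} fresh g with RedWalk? h (lo e) (hi e)
... | yes walk = paintBlue fresh walk g
... | no ¬walk = paintRed fresh ¬walk g

play-greedy : ∀ σ t → Greedy (play σ greedy t)
play-greedy σ zero    = []
play-greedy σ (suc t) = paint-greedy (proj₂ (σ _)) (play-greedy σ t)

length-play : ∀ σ π t → length (play σ π t) ≡ t
length-play σ π zero    = refl
length-play σ π (suc t) = cong suc (length-play σ π t)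

-- The walk that justified painting the edge blue survives all later rounds.
greedy-blue : Greedy h → HasEdge blue h u v → RedWalk h u v
greedy-blue (paintRed _ _ g) (e , there e∈h , j) = RedWalk-there (greedy-blue g (e , e∈h , j))
greedy-blue (paintBlue _ walk g) (e , here refl , inj₁ (refl , refl)) = RedWalk-there walk
greedy-blue (paintBlue _ walk g) (e , here refl , inj₂ (refl , refl)) =
  RedWalk-there (RedWalk-sym walk)
greedy-blue (paintBlue _ _ g) (e , there e∈h , j) = RedWalk-there (greedy-blue g (e , e∈h , j))

greedy-disjoint : Greedy h → (e , red) ∈ h → (e , blue) ∈ h → ⊥
greedy-disjoint (paintRed fresh _ g)  (here refl) (there b)   = fresh (∈-map⁺ proj₁ b)
greedy-disjoint (paintRed _ _ g)      (there r)   (there b)   = greedy-disjoint g r b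
greedy-disjoint (paintBlue fresh _ g) (there r)   (here refl) = fresh (∈-map⁺ proj₁ r)
greedy-disjoint (paintBlue _ _ g)     (there r)   (there b)   = greedy-disjoint g r b

greedy-clash : Greedy h → HasEdge red h u v → HasEdge blue h u v → ⊥
greedy-clash g (e , e∈h , j) (e′ , e′∈h , j′) with refl ← Joins-injective {e = e} {e′ = e′} j j′ =
  greedy-disjoint g e∈h e′∈h

-- From `v` the newest edge leads only to `u`.
adjacent-old : Joins e u v → HasEdge c ((e , c) ∷ h) v w → u ≢ w → HasEdge c h v w
adjacent-old {e} j vw u≢w with HasEdge-here⁻ vw
... | inj₂ vw = vw
... | inj₁ j′ with Joins-unique {e} j j′
...   | inj₁ (refl , refl) = ⊥-elim (Joins-irrefl {e} j)
...   | inj₂ (u≡w , _)     = ⊥-elim (u≢w u≡w)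

-- With the newest edge as the side uv, the other three sides are older and form a red walk from `v`
-- to `u`, so Painter would have painted that edge blue.
noClosingEdge : let h′ = (e , red) ∷ h in
                ¬ RedWalk h (lo e) (hi e) → Joins e u v →
                HasEdge red h′ v w → HasEdge red h′ w x → HasEdge red h′ x u →
                u ≢ w → v ≢ x → ⊥
noClosingEdge {e} {h} {u} {v} {w} {x} ¬walk j vw wx xu u≢w v≢x with HasEdge-here⁻ wx
... | inj₂ wx-old = noWalk j walk
  where
  walk : RedWalk h v u
  walk = w , x , adjacent-old {e} j vw u≢w , wx-old
       , HasEdge-sym (adjacent-old {e} (swap j) (HasEdge-sym xu) v≢x)

  noWalk : Joins e u v → ¬ RedWalk h v u
  noWalk (inj₁ (refl , refl)) = ¬walk ∘ RedWalk-sym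
  noWalk (inj₂ (refl , refl)) = ¬walk
-- The opposite side wx cannot be the newest edge: either `u` would equal `w`, or the side xu would
-- be a loop.
... | inj₁ j′ with Joins-unique {e} j j′
...   | inj₁ (u≡w , _)  = u≢w u≡w
...   | inj₂ (refl , _) = HasEdge-irrefl xu

-- When a red round completes the cycle, its edge is one of the four sides. Rotating the cycle makes
-- it the first side, as `noClosingEdge` expects.
greedy-noRedC₄ : Greedy h → HasEdge red h u v → HasEdge red h v w → HasEdge red h w x →
                 HasEdge red h x u → u ≢ w → v ≢ x → ⊥
greedy-noRedC₄ (paintBlue _ _ g) uv vw wx xu = greedy-noRedC₄ g (old uv) (old vw) (old wx) (old xu)
  where
  old : HasEdge red ((e , blue) ∷ h) u v → HasEdge red h u v
  old (_ , there e∈h , j) = _ , e∈h , j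
greedy-noRedC₄ (paintRed _ ¬walk g) uv vw wx xu u≢w v≢x
  with HasEdge-here⁻ uv | HasEdge-here⁻ vw | HasEdge-here⁻ wx | HasEdge-here⁻ xu
... | inj₁ j | _ | _ | _ = noClosingEdge ¬walk j vw wx xu u≢w v≢x
... | _ | inj₁ j | _ | _ = noClosingEdge ¬walk j wx xu uv v≢x (u≢w ∘ sym)
... | _ | _ | inj₁ j | _ = noClosingEdge ¬walk j xu uv vw (u≢w ∘ sym) (v≢x ∘ sym)
... | _ | _ | _ | inj₁ j = noClosingEdge ¬walk j uv vw wx (v≢x ∘ sym) u≢w
... | inj₂ uv | inj₂ vw | inj₂ wx | inj₂ xu = greedy-noRedC₄ g uv vw wx xu u≢w v≢x

-- Colour classes and connectedness.

edgesOf : Colour → History → List Edge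
edgesOf c h = map proj₁ (filter ((c ≟ᶜ_) ∘ proj₂) h)

length-edgesOf : ∀ h → length (edgesOf red h) + length (edgesOf blue h) ≡ length h
length-edgesOf []               = refl
length-edgesOf ((_ , red)  ∷ h) = cong suc (length-edgesOf h)
length-edgesOf ((_ , blue) ∷ h) = trans (+-suc _ _) (cong suc (length-edgesOf h))

OnEnds : Rel ℕ 0ℓ → Edge → Set
OnEnds R e = R (lo e) (hi e)

-- `OnEnds` tests only the orientation from `lo` to `hi`, whereas `HasEdge` allows both; symmetry
-- bridges the two.
HasEdge⇒ : ∀ {R : Rel ℕ 0ℓ} → Symmetric R → All (OnEnds R) (edgesOf c h) →
           HasEdge c h u v → R u v
HasEdge⇒ {c} {R = R} R-sym all (e , e∈h , j) = orient j (All.lookup all e∈edges)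
  where
  e∈edges = ∈-map⁺ proj₁ (∈-filter⁺ ((c ≟ᶜ_) ∘ proj₂) e∈h refl)

  orient : Joins e u v → OnEnds R e → R u v
  orient (inj₁ (refl , refl)) = id
  orient (inj₂ (refl , refl)) = R-sym

_≡[_]_ : ℕ → (ℕ → ℕ) → ℕ → Set
u ≡[ f ] v = f u ≡ f v

Respects : (ℕ → ℕ) → List Edge → Set
Respects f = All (OnEnds (_≡[ f ]_))

-- Connectedness, as agreement of all labellings that are constant along edges.
Connected : List Edge → Rel ℕ 0ℓ
Connected E u v = ∀ f → Respects f E → u ≡[ f ] v

Connected-trans : Connected E u v → Connected E v w → Connected E u w
Connected-trans uv vw f f-resp = trans (uv f f-resp) (vw f f-resp)

HasEdge⇒Connected : HasEdge c h u v → Connected (edgesOf c h) u v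
HasEdge⇒Connected uv f f-resp = HasEdge⇒ sym f-resp uv

RedWalk⇒Connected : RedWalk h u v → Connected (edgesOf red h) u v
RedWalk⇒Connected (_ , _ , uw , wx , xv) =
  Connected-trans (HasEdge⇒Connected uw)
    (Connected-trans (HasEdge⇒Connected wx) (HasEdge⇒Connected xv))

-- Component labels and the number of edges of a connected graph.

redirect : ℕ → ℕ → ℕ → ℕ
redirect a b n with n ≟ b
... | yes _ = a
... | no  _ = n

redirect-target : ∀ a b → redirect a b b ≡ a
redirect-target a b with b ≟ b
... | yes _  = refl
... | no b≢b = ⊥-elim (b≢b refl)

redirect-≢ : ∀ a {b n} → n ≢ b → redirect a b n ≡ n
redirect-≢ a {b} {n} n≢b with n ≟ b
... | yes n≡b = ⊥-elim (n≢b n≡b)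
... | no _    = refl

redirect-source : ∀ a b → redirect a b a ≡ a
redirect-source a b with a ≟ b
... | yes _ = refl
... | no  _ = refl

-- The quick-find form of union-find: vertices start as their own labels, and each edge renames the
-- label of one end to that of the other.
component : List Edge → ℕ → ℕ
component []      v = v
component (e ∷ E) v = redirect (component E (lo e)) (component E (hi e)) (component E v)

component-respects : ∀ E → Respects (component E) E
component-respects []      = []
component-respects (e ∷ E) =
  trans (redirect-source a b) (sym (redirect-target a b)) ∷
  All.map (cong (redirect a b)) (component-respects E)
  where
  a = component E (lo e)
  b = component E (hi e)

-- The converse comes from applying `Connected` to `component E` itself, by `component-respects`.
-- Equality of labels therefore decides connectedness.
component-connected : ∀ E → u ≡[ component E ] v → Connected E u v
component-connected []      u≡v f _ = cong f u≡v
component-connected {u} {v} (e ∷ E) eq f (fe ∷ fE)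
  with component E u ≟ component E (hi e) | component E v ≟ component E (hi e)
... | yes u~hi | yes v~hi =
  component-connected E (trans u~hi (sym v~hi)) f fE
-- Only `u` is relabelled, so `eq` puts `v` into the old component of `lo e`, and `e` itself is the
-- bridge.
... | yes u~hi | no  _    =
  trans (component-connected E u~hi f fE) (trans (sym fe) (component-connected E eq f fE))
... | no  _    | yes v~hi =
  trans (component-connected E eq f fE) (trans fe (sym (component-connected E v~hi f fE)))
... | no  _    | no  _    = component-connected E eq f fE

others : ℕ → List ℕ → List ℕ
others a = filter (λ n → ¬? (n ≟ a))

-- In a list without repetitions at most one entry equals `a`.
length-others : ∀ a {xs} → Unique xs → length xs ≤ suc (length (others a xs))
length-others a [] = z≤n
length-others a {n ∷ xs} (n∉xs ∷ xs!) with n ≟ a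
... | no n≢a
  rewrite filter-accept (λ n → ¬? (n ≟ a)) {xs = xs} n≢a = s≤s (length-others a xs!)
... | yes refl
  rewrite filter-reject (λ n → ¬? (n ≟ a)) {xs = xs} (λ n≢n → n≢n refl)
        | filter-all (λ n → ¬? (n ≟ a)) (All.map (_∘ sym) n∉xs) = ≤-refl

IsLabel : List Edge → List ℕ → ℕ → Set
IsLabel E V n = ∃[ v ] v ∈ V × component E v ≡ n

-- Every edge merges at most two components.
distinctLabels : ∀ E {V} → Unique V → ∃[ S ] Unique S × All (IsLabel E V) S ×
                 length V ≤ length E + length S
distinctLabels [] {V} V! = V , V! , All.tabulate (λ v∈V → _ , v∈V , refl) , ≤-refl
distinctLabels (e ∷ E) {V} V! with distinctLabels E V!
... | S , S! , S-labels , |V|≤ =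
  -- The new edge renames only the label `b`, so all other labels in `S` stay in use.
  others b S , Unique.filter⁺ ≢b? S! ,
  All.zipWith kept (All.all-filter ≢b? S , All.filter⁺ ≢b? S-labels) ,
  ≤-trans |V|≤ (≤-trans (+-monoʳ-≤ (length E) (length-others b S!)) (≤-reflexive (+-suc _ _)))
  where
  a = component E (lo e)
  b = component E (hi e)
  ≢b? = λ n → ¬? (n ≟ b)

  kept : ∀ {n} → n ≢ b × IsLabel E V n → IsLabel (e ∷ E) V n
  kept (n≢b , v , v∈V , refl) = v , v∈V , redirect-≢ a n≢b

-- All vertices in `V` carry the label of `r`, so the list given by `distinctLabels` has at most one
-- entry and the edges account for the rest of `V`.
connected⇒length≤ : ∀ {V} → Unique V → All (Connected E r) V → length V ≤ suc (length E)
connected⇒length≤ {E} {r} {V} V! conn with distinctLabels E V!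
... | S , S! , S-labels , |V|≤ =
  ≤-trans |V|≤ (≤-trans (+-monoʳ-≤ (length E) (one S! S-labels)) (≤-reflexive (+-comm _ 1)))
  where
  label≡ : ∀ {n} → IsLabel E V n → component E r ≡ n
  label≡ (v , v∈V , refl) = All.lookup conn v∈V (component E) (component-respects E)

  one : ∀ {S} → Unique S → All (IsLabel E V) S → length S ≤ 1
  one []                []          = z≤n
  one (_ ∷ [])          (_ ∷ [])    = ≤-refl
  one ((n≢m ∷ _) ∷ _) (n ∷ m ∷ _) = ⊥-elim (n≢m (trans (sym (label≡ n)) (label≡ m)))

-- Two-colourings of graphs without redundant edges.

Opposite : (ℕ → Bool) → Rel ℕ 0ℓ
Opposite p u v = p v ≡ not (p u)

Opposite-sym : ∀ p → Symmetric (Opposite p)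
Opposite-sym p eq = trans (sym (not-involutive _)) (cong not (sym eq))

-- If the ends of an edge are already connected the edge is redundant; otherwise
-- the colouring can be flipped on the component of one end.
twoColour : ∀ E → (∃[ p ] All (OnEnds (Opposite p)) E) ⊎
            (∃[ E′ ] length E′ < length E × (∀ {u v} → Connected E u v → Connected E′ u v))
twoColour [] = inj₁ ((λ _ → true) , [])
twoColour (e ∷ E) with twoColour E
... | inj₂ (E′ , shorter , conn) = inj₂ (e ∷ E′ , s≤s shorter , conn′)
  where
  conn′ : ∀ {u v} → Connected (e ∷ E) u v → Connected (e ∷ E′) u v
  -- Each edge `d` of `E` connects its ends in `E`, hence in `E′`, so a labelling that respects `E′`
  -- also respects `E`.
  conn′ uv f (fe ∷ fE′) = uv f (fe ∷ All.tabulate λ {d} d∈E →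
    conn {lo d} {hi d} (λ g gE → All.lookup gE d∈E) f fE′)
... | inj₁ (p , alternates) with component E (lo e) ≟ component E (hi e)
...   | yes lo~hi = inj₂ (E , ≤-refl , λ uv f fE → uv f (component-connected E lo~hi f fE ∷ fE))
...   | no  lo≁hi with p (hi e) Bool.≟ not (p (lo e))
...     | yes opposite = inj₁ (p , opposite ∷ alternates)
...     | no ¬opposite = inj₁ (q , here-opposite ∷
            All.zipWith (λ {d} → there-opposite {d}) (component-respects E , alternates))
  where
  b = component E (hi e)

  q : ℕ → Bool
  q v = does (component E v ≟ b) xor p v

  here-opposite : OnEnds (Opposite q) e
  here-opposite rewrite dec-true (b ≟ b) refl | dec-false (component E (lo e) ≟ b) lo≁hi =
    cong not (trans (¬-not ¬opposite) (not-involutive _))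

  there-opposite : ∀ {d} → OnEnds (_≡[ component E ]_) d × OnEnds (Opposite p) d →
                   OnEnds (Opposite q) d
  there-opposite {d} (lo~hi , opp) rewrite lo~hi | opp =
    sym (not-distribʳ-xor (does (component E (hi d) ≟ b)) _)

-- Three changes of colour amount to one.
RedWalk⇒Opposite : ∀ p → All (OnEnds (Opposite p)) (edgesOf red h) →
                   RedWalk h u v → Opposite p u v
RedWalk⇒Opposite p opp (_ , _ , uw , wx , xv) =
  trans (along xv) (cong not (trans (along wx) (trans (cong not (along uw)) (not-involutive _))))
  where
  along : ∀ {u v} → HasEdge red _ u v → Opposite p u v
  along = HasEdge⇒ (Opposite-sym p) opp

-- Vertices and steps of a copy of a path.

module PathCopy {k} (f : Fin (suc k) ↣ ℕ) where

  vertex : Fin (suc k) → ℕ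
  vertex = Injection.to f

  vertices : List ℕ
  vertices = tabulate vertex

  vertices-unique : Unique vertices
  vertices-unique = Unique.tabulate⁺ (Injection.injective f)

  module _ (adj : ∀ {i j} → PathStep i j → HasEdge c h (vertex i) (vertex j)) where

    steps : ∀ i → HasEdge c h (vertex (inject₁ i)) (vertex (suc i))
    steps i = adj (cong suc (Fin.toℕ-inject₁ i))

    -- `E` is kept general to serve both counts: a step of the blue path is itself a blue edge, and
    -- its ends are also connected by a red walk.
    connected : (∀ {u v} → HasEdge c h u v → Connected E u v) →
                All (Connected E (vertex zero)) vertices
    connected conn = All.tabulate⁺ (<-weakInduction (λ i → Connected _ (vertex zero) (vertex i))
      (λ _ _ → refl) (λ i vi → Connected-trans vi (conn (steps i))))

-- The lower bound.

greedy-noRedC₄Copy : Greedy h → ¬ Copy red (cycle 4) h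
greedy-noRedC₄Copy g (f , adj) =
  greedy-noRedC₄ g (adj {# 0} {# 1} (inj₁ (inj₁ refl))) (adj {# 1} {# 2} (inj₁ (inj₁ refl)))
    (adj {# 2} {# 3} (inj₁ (inj₁ refl))) (adj {# 3} {# 0} (inj₁ (inj₂ (refl , refl))))
    (distinct λ ()) (distinct λ ())
  where
  distinct : ∀ {i j} → i ≢ j → Injection.to f i ≢ Injection.to f j
  distinct i≢j = i≢j ∘ Injection.injective f

-- With at most five red edges, v₁ and v₄ could have no red neighbours but each
-- other, so that no red walk of length three would lead from v₁ to v₂.
greedy-redEdges : Greedy h → Copy blue (path 6) h → 6 ≤ length (edgesOf red h)
greedy-redEdges {h} g (f , adj) = ≰⇒> absurd
  where
  open PathCopy f
  open DecMembership _≟_ using (_∈?_)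

  R = edgesOf red h
  v₁ = vertex (# 1)
  v₂ = vertex (# 2)
  v₄ = vertex (# 4)

  blueStep : ∀ {i j} → PathStep i j → HasEdge blue h (vertex i) (vertex j)
  blueStep = adj ∘ inj₁

  red-connected : All (Connected R (vertex zero)) vertices
  red-connected = connected blueStep (RedWalk⇒Connected ∘ greedy-blue g)

  module _ (few : length R ≤ 5) where

    -- A red neighbour off the path would be a seventh vertex connected in red, which takes six red
    -- edges.
    neighbour : ∀ i {w} → HasEdge red h (vertex i) w → ∃[ j ] w ≡ vertex j
    neighbour i {w} iw with w ∈? vertices
    ... | yes w∈ = ∈-tabulate⁻ w∈
    ... | no w∉ = ⊥-elim (n≮n _ (≤-trans (connected⇒length≤
      (All.¬Any⇒All¬ _ w∉ ∷ vertices-unique)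
      (Connected-trans (All.tabulate⁻ {f = vertex} red-connected i) (HasEdge⇒Connected iw) ∷
       red-connected))
      (s≤s few)))

    -- If a red edge were redundant, at most four edges would connect six vertices.
    proper : ∃[ p ] All (OnEnds (Opposite p)) R
    proper with twoColour R
    ... | inj₁ p = p
    ... | inj₂ (E′ , shorter , conn) = ⊥-elim (n≮n _ (≤-trans
      (connected⇒length≤ vertices-unique (All.map (λ {u} → conn {vertex zero} {u}) red-connected))
      (≤-trans shorter few)))

    p = proj₁ proper

    red-opposite : ∀ {u w} → HasEdge red h u w → Opposite p u w
    red-opposite = HasEdge⇒ (Opposite-sym p) (proj₂ proper)

    alternating : ∀ {i j} → PathStep i j → Opposite p (vertex i) (vertex j)
    alternating ij = RedWalk⇒Opposite p (proj₂ proper) (greedy-blue g (blueStep ij))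

    twoSteps : ∀ {i j k} → PathStep i j → PathStep j k → p (vertex i) ≡ p (vertex k)
    twoSteps ij jk =
      sym (trans (alternating jk) (trans (cong not (alternating ij)) (not-involutive _)))

    sameSide : ∀ {u w} → p u ≡ p w → ¬ HasEdge red h u w
    sameSide pu≡pw uw = not-¬ (sym pu≡pw) (red-opposite uw)

    consecutive : ∀ {i j} → PathStep i j → ¬ HasEdge red h (vertex i) (vertex j)
    consecutive ij r = greedy-clash g r (blueStep ij)

    -- The path vertices next to `v₁` are joined to it in blue, and those at even distance along the
    -- path have its colour under `p`; only `v₄` remains.
    v₁-neighbour : ∀ {w} → HasEdge red h v₁ w → w ≡ v₄
    v₁-neighbour v₁w with neighbour (# 1) v₁w
    ... | zero , refl = ⊥-elim (consecutive refl (HasEdge-sym v₁w))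
    ... | suc zero , refl = ⊥-elim (sameSide refl v₁w)
    ... | suc (suc zero) , refl = ⊥-elim (consecutive refl v₁w)
    ... | suc (suc (suc zero)) , refl = ⊥-elim (sameSide (twoSteps {j = # 2} refl refl) v₁w)
    ... | suc (suc (suc (suc zero))) , refl = refl
    ... | suc (suc (suc (suc (suc zero)))) , refl =
      ⊥-elim (sameSide (trans (twoSteps {j = # 2} {# 3} refl refl)
                              (twoSteps {j = # 4} refl refl)) v₁w)

    v₄-neighbour : ∀ {w} → HasEdge red h v₄ w → w ≡ v₁
    v₄-neighbour v₄w with neighbour (# 4) v₄w
    ... | zero , refl =
      ⊥-elim (sameSide (sym (trans (twoSteps {j = # 1} {# 2} refl refl)
                                   (twoSteps {j = # 3} refl refl))) v₄w)
    ... | suc zero , refl = refl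
    ... | suc (suc zero) , refl = ⊥-elim (sameSide (sym (twoSteps {j = # 3} refl refl)) v₄w)
    ... | suc (suc (suc zero)) , refl = ⊥-elim (consecutive refl (HasEdge-sym v₄w))
    ... | suc (suc (suc (suc zero))) , refl = ⊥-elim (sameSide refl v₄w)
    ... | suc (suc (suc (suc (suc zero)))) , refl = ⊥-elim (consecutive refl v₄w)

    absurd : ⊥
    -- The walk from `v₁` must go to `v₄` and back to `v₁`, so its last edge would be a red edge
    -- between `v₁` and `v₂`, which are joined in blue.
    absurd with greedy-blue g (blueStep {# 1} {# 2} refl)
    ... | w , x , v₁w , wx , xv₂
      with refl ← v₁-neighbour v₁w
      with refl ← v₄-neighbour wx = consecutive refl xv₂

greedy-survives : Greedy h → Won (cycle 4) (path 6) h → 11 ≤ length h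
greedy-survives g (inj₁ redC₄)  = ⊥-elim (greedy-noRedC₄Copy g redC₄)
greedy-survives {h} g (inj₂ blueP₆@(f , adj)) =
  -- Six red edges and five blue ones.
  subst (11 ≤_) (length-edgesOf h) (+-mono-≤ (greedy-redEdges g blueP₆) (s≤s⁻¹ blueEdges))
  where
  open PathCopy f

  blueEdges : 6 ≤ suc (length (edgesOf blue h))
  blueEdges = connected⇒length≤ vertices-unique (connected (adj ∘ inj₁) HasEdge⇒Connected)

lowerBound : ∀ t → BuilderCanWinWithin (cycle 4) (path 6) t → 11 ≤ t
lowerBound t (σ , wins) with wins greedy
... | s , s≤t , won =
  ≤-trans (subst (11 ≤_) (length-play σ greedy s) (greedy-survives (play-greedy σ s) won)) s≤t

-- Decision trees as strategies for Builder.

Fresh? : ∀ h e → Dec (Fresh h e)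
Fresh? h e = e ∉? map proj₁ h
  where open DecMembership _≟ᵉ_ using (_∉?_)

-- The default move: its upper end exceeds the upper ends of all edges drawn so far.
someFresh : ∀ h → Σ[ e ∈ Edge ] Fresh h e
someFresh h = edge 0 (suc m) z<s , λ e∈ →
  n≮n m (All.lookup (xs≤max 0 (map hi edges)) (∈-map⁺ hi e∈))
  where
  edges = map proj₁ h
  m = max 0 (map hi edges)

-- A leaf names the vertices of the copy it claims, so checking a tree involves no search for
-- copies.
data Plan (G H : Graph) : Set where
  redCopy  : Vec ℕ (Graph.order G) → Plan G H
  blueCopy : Vec ℕ (Graph.order H) → Plan G H
  draw     : Edge → (ifRed ifBlue : Plan G H) → Plan G H

rounds : Plan G H → ℕ
rounds (redCopy _)  = 0
rounds (blueCopy _) = 0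
rounds (draw _ p q) = suc (rounds p ⊔ rounds q)

-- `Copy` with the injection given as a table of values; the quantifiers range over `Fin`, which
-- makes it decidable for decidable adjacency.
IsCopy : Colour → (G : Graph) → History → Vec ℕ (Graph.order G) → Set
IsCopy c G h vs =
  (∀ i j → lookup vs i ≡ lookup vs j → i ≡ j) ×
  (∀ i j → Graph.Adj G i j → HasEdge c h (lookup vs i) (lookup vs j))

toCopy : ∀ G vs → IsCopy c G h vs → Copy c G h
toCopy G vs (inj , adj) = mk↣ {to = lookup vs} (λ {i} {j} → inj i j) , λ {i} {j} → adj i j

-- The two subtrees cover all replies, so Painter's strategy does not enter and the condition can be
-- evaluated.
Winning : Plan G H → History → Set
Winning {G = G} (redCopy vs) h  = IsCopy red G h vs
Winning {H = H} (blueCopy vs) h = IsCopy blue H h vs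
Winning (draw e p q) h =
  Fresh h e × Winning p ((e , red) ∷ h) × Winning q ((e , blue) ∷ h)

isCopy? : ∀ G → Decidable (Graph.Adj G) → ∀ c h vs → Dec (IsCopy c G h vs)
isCopy? G adj? c h vs =
  Fin.all? (λ i → Fin.all? λ j → (lookup vs i ≟ lookup vs j) →-dec (i Fin.≟ j)) ×-dec
  Fin.all? (λ i → Fin.all? λ j → adj? i j →-dec HasEdge? c h (lookup vs i) (lookup vs j))

module _ (adjᴳ? : Decidable (Graph.Adj G)) (adjᴴ? : Decidable (Graph.Adj H)) where

  winning? : ∀ (p : Plan G H) h → Dec (Winning p h)
  winning? (redCopy vs)  h = isCopy? G adjᴳ? red h vs
  winning? (blueCopy vs) h = isCopy? H adjᴴ? blue h vs
  winning? (draw e p q)  h =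
    Fresh? h e ×-dec winning? p ((e , red) ∷ h) ×-dec winning? q ((e , blue) ∷ h)

after : Plan G H → Colour → Plan G H
after (draw _ p q) red  = p
after (draw _ p q) blue = q
-- A leaf absorbs further rounds, since a strategy must also answer histories that go on after a
-- win.
after p            _    = p

-- Only the colours are read, since along a play of the plan they determine the edges.
afterHistory : Plan G H → History → Plan G H
afterHistory p []            = p
afterHistory p ((_ , c) ∷ h) = after (afterHistory p h) c

-- The default covers leaves and histories that do not come from following the plan, where the
-- planned edge may already be taken.
move : Plan G H → ∀ h → Σ[ e ∈ Edge ] Fresh h e
move (draw e _ _) h with Fresh? h e
... | yes fresh = e , fresh
... | no _      = someFresh h
move _ h = someFresh h

follow : Plan G H → BuilderStrategy
follow p h = move (afterHistory p h) h

move-draw : ∀ (p q : Plan G H) h → Fresh h e → proj₁ (move (draw e p q) h) ≡ e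
move-draw {e = e} _ _ h fresh with Fresh? h e
... | yes _     = refl
... | no ¬fresh = ⊥-elim (¬fresh fresh)

module _ (p : Plan G H) (π : PainterStrategy) where

  private
    position : ℕ → History
    position = play (follow p) π

  -- Induction on the subtree `q` still to be played after `s` rounds; the equation ties `q` to the
  -- actual play.
  wins-from : ∀ s q → afterHistory p (position s) ≡ q → Winning q (position s) →
              ∃[ t ] t ≤ s + rounds q × Won G H (position t)
  wins-from s (redCopy vs)  _ copy = s , m≤m+n s 0 , inj₁ (toCopy G vs copy)
  wins-from s (blueCopy vs) _ copy = s , m≤m+n s 0 , inj₂ (toCopy H vs copy)
  -- The reply is passed along with an equation, so that the case split on its colour can be carried
  -- over to `position (suc s)`.
  wins-from s (draw e q r) at (fresh , q-wins , r-wins) = respond (π now e) refl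
    where
    now = position s

    drawn : proj₁ (follow p now) ≡ e
    drawn = trans (cong (λ q → proj₁ (move q now)) at) (move-draw q r now fresh)

    next : ∀ {c} → π now e ≡ c → position (suc s) ≡ (e , c) ∷ now
    next π≡c = trans (cong (λ e → (e , π now e) ∷ now) drawn) (cong (λ c → (e , c) ∷ now) π≡c)

    next-at : ∀ {c} → π now e ≡ c → afterHistory p (position (suc s)) ≡ after (draw e q r) c
    next-at π≡c = trans (cong (afterHistory p) (next π≡c)) (cong (λ q → after q _) at)

    later : ∀ q′ → rounds q′ ≤ rounds q ⊔ rounds r →
            ∃[ t ] t ≤ suc s + rounds q′ × Won G H (position t) →
            ∃[ t ] t ≤ s + suc (rounds q ⊔ rounds r) × Won G H (position t)
    later q′ q′≤ (t , t≤ , won) =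
      t , ≤-trans t≤ (≤-trans (s≤s (+-monoʳ-≤ s q′≤)) (≤-reflexive (sym (+-suc s _)))) , won

    respond : ∀ c → π now e ≡ c → ∃[ t ] t ≤ s + suc (rounds q ⊔ rounds r) × Won G H (position t)
    respond red π≡red = later q (m≤m⊔n _ _)
      (wins-from (suc s) q (next-at π≡red) (subst (Winning q) (sym (next π≡red)) q-wins))
    respond blue π≡blue = later r (m≤n⊔m _ _)
      (wins-from (suc s) r (next-at π≡blue) (subst (Winning r) (sym (next π≡blue)) r-wins))

follow-wins : ∀ (p : Plan G H) → Winning p [] → BuilderCanWinWithin G H (rounds p)
follow-wins p p-wins = follow p , λ π → wins-from p π 0 p refl p-wins

-- The explicit tree and its verification.

pathStep? : ∀ {k} → Decidable (PathStep {k})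
pathStep? i j = suc (toℕ i) ≟ toℕ j

pathAdj? : ∀ k → Decidable (Graph.Adj (path k))
pathAdj? k i j = pathStep? i j ⊎-dec pathStep? j i

cycleStep? : ∀ {k} → Decidable (CycleStep {k})
cycleStep? {k} i j = pathStep? i j ⊎-dec (suc (toℕ i) ≟ k ×-dec toℕ j ≟ 0)

cycleAdj? : ∀ k {3≤k} → Decidable (Graph.Adj (cycle k {3≤k}))
cycleAdj? k i j = cycleStep? i j ⊎-dec cycleStep? j i

_─_ : ∀ u v {u<v : True (u <? v)} → Edge
_─_ u v {u<v} = edge u v (toWitness u<v)

c₄ : (u v w x : ℕ) → Plan (cycle 4) (path 6)
c₄ u v w x = redCopy (u ∷ v ∷ w ∷ x ∷ [])

p₆ : (u v w x y z : ℕ) → Plan (cycle 4) (path 6)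
p₆ u v w x y z = blueCopy (u ∷ v ∷ w ∷ x ∷ y ∷ z ∷ [])

-- A `draw` with a leaf on one side only forces the reply: the other colour loses at once.
strategy : Plan (cycle 4) (path 6)
strategy =
  draw (0 ─ 1)
   -- The second edge is disjoint from the first whatever the reply, so up to relabelling three
   -- positions arise after two rounds: both edges red, one of each colour, both blue.
   (draw (2 ─ 3)
    -- Both edges red: a second connecting edge at the far ends is forced to be blue once `0 ─ 2` is
    -- red.
    (draw (0 ─ 2)
     (draw (1 ─ 3) (c₄ 0 1 3 2)
      (draw (0 ─ 3)
       (draw (1 ─ 2) (c₄ 0 1 2 3)
        (draw (0 ─ 4)
         (draw (2 ─ 4) (c₄ 0 3 2 4)
          (draw (3 ─ 5)
           (draw (0 ─ 5) (c₄ 0 2 3 5) (draw (4 ─ 5) (c₄ 0 3 5 4) (p₆ 0 5 4 2 1 3)))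
           (draw (1 ─ 6)
            (draw (4 ─ 6) (c₄ 0 1 6 4) (p₆ 5 3 1 2 4 6))
            (draw (3 ─ 4) (c₄ 0 2 3 4) (p₆ 5 3 4 2 1 6)))))
         (draw (2 ─ 4)
          (draw (3 ─ 4) (c₄ 0 2 4 3)
           (draw (0 ─ 5)
            (draw (2 ─ 5) (c₄ 0 3 2 5) (p₆ 0 4 3 1 2 5))
            (p₆ 2 1 3 4 0 5)))
          (draw (0 ─ 5)
           (draw (3 ─ 5) (c₄ 0 2 3 5) (p₆ 0 4 2 1 3 5))
           (p₆ 3 1 2 4 0 5)))))
       (draw (1 ─ 4)
        (draw (2 ─ 4) (c₄ 0 1 4 2)
         (draw (1 ─ 2)
          (draw (0 ─ 4) (c₄ 0 2 1 4)
           (draw (1 ─ 5)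
            (draw (2 ─ 5) (c₄ 0 1 5 2) (p₆ 1 3 0 4 2 5))
            (p₆ 2 4 0 3 1 5)))
          (draw (0 ─ 5)
           (draw (4 ─ 5) (c₄ 0 1 4 5) (p₆ 0 3 1 2 4 5))
           (p₆ 4 2 1 3 0 5))))
        (draw (2 ─ 5)
         (draw (1 ─ 5) (c₄ 0 1 5 2)
          (draw (0 ─ 6)
           (draw (3 ─ 6) (c₄ 0 2 3 6) (draw (5 ─ 6) (c₄ 0 2 5 6) (p₆ 0 3 6 5 1 4)))
           (draw (3 ─ 4)
            (draw (4 ─ 5) (c₄ 2 3 4 5) (p₆ 4 5 1 3 0 6))
            (p₆ 5 1 4 3 0 6))))
         (draw (0 ─ 5)
          (draw (2 ─ 4)
           (draw (4 ─ 5) (c₄ 0 2 4 5) (p₆ 0 3 1 4 5 2))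
           (p₆ 0 3 1 4 2 5))
          (p₆ 2 5 0 3 1 4))))))
     (draw (0 ─ 3)
      (draw (1 ─ 2) (c₄ 0 1 2 3)
       (draw (1 ─ 4)
        (draw (3 ─ 4) (c₄ 0 1 4 3)
         (draw (1 ─ 3)
          (draw (0 ─ 4) (c₄ 0 3 1 4)
           (draw (1 ─ 5)
            (draw (3 ─ 5) (c₄ 0 1 5 3) (p₆ 1 2 0 4 3 5))
            (p₆ 3 4 0 2 1 5)))
          (draw (0 ─ 5)
           (draw (4 ─ 5) (c₄ 0 1 4 5) (p₆ 0 2 1 3 4 5))
           (p₆ 4 3 1 2 0 5))))
        (draw (3 ─ 5)
         (draw (1 ─ 5) (c₄ 0 1 5 3)
          (draw (0 ─ 6)
           (draw (2 ─ 6) (c₄ 0 3 2 6) (draw (5 ─ 6) (c₄ 0 3 5 6) (p₆ 0 2 6 5 1 4)))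
           (draw (2 ─ 4)
            (draw (4 ─ 5) (c₄ 2 3 5 4) (p₆ 4 5 1 2 0 6))
            (p₆ 5 1 4 2 0 6))))
         (draw (0 ─ 5)
          (draw (3 ─ 4)
           (draw (4 ─ 5) (c₄ 0 3 4 5) (p₆ 0 2 1 4 5 3))
           (p₆ 0 2 1 4 3 5))
          (p₆ 3 5 0 2 1 4)))))
      (draw (2 ─ 4)
       (draw (1 ─ 3)
        (draw (1 ─ 4) (c₄ 1 3 2 4)
         (draw (1 ─ 2)
          (draw (3 ─ 4) (c₄ 1 2 4 3)
           (draw (1 ─ 5)
            (draw (2 ─ 5) (c₄ 1 3 2 5) (p₆ 1 4 3 0 2 5))
            (p₆ 2 0 3 4 1 5)))
          (draw (3 ─ 5)
           (draw (4 ─ 5) (c₄ 2 3 5 4) (p₆ 3 0 2 1 4 5))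
           (p₆ 4 1 2 0 3 5))))
        (draw (4 ─ 5)
         (draw (3 ─ 5) (c₄ 2 3 5 4)
          (draw (1 ─ 5)
           (draw (0 ─ 4) (c₄ 0 1 5 4) (draw (1 ─ 2) (c₄ 1 2 4 5) (p₆ 4 0 2 1 3 5)))
           (draw (2 ─ 6)
            (draw (5 ─ 6) (c₄ 2 4 5 6) (p₆ 2 0 3 1 5 6))
            (p₆ 1 5 3 0 2 6))))
         (draw (1 ─ 4)
          (draw (1 ─ 5)
           (draw (2 ─ 5) (c₄ 1 4 2 5) (p₆ 1 3 0 2 5 4))
           (p₆ 2 0 3 1 5 4))
          (p₆ 2 0 3 1 4 5))))
       (draw (1 ─ 3)
        (draw (1 ─ 5)
         (draw (2 ─ 5) (c₄ 1 3 2 5)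
          (draw (3 ─ 6)
           (draw (0 ─ 6) (c₄ 0 1 3 6) (draw (5 ─ 6) (c₄ 1 3 6 5) (p₆ 3 0 6 5 2 4)))
           (draw (0 ─ 4)
            (draw (4 ─ 5) (c₄ 0 1 5 4) (p₆ 4 5 2 0 3 6))
            (p₆ 5 2 4 0 3 6))))
         (draw (1 ─ 4)
          (draw (3 ─ 5)
           (draw (4 ─ 5) (c₄ 1 3 5 4) (p₆ 1 5 4 2 0 3))
           (p₆ 1 5 3 0 2 4))
          (p₆ 3 0 2 4 1 5)))
        (draw (1 ─ 5)
         (draw (1 ─ 6)
          (draw (4 ─ 5)
           (draw (4 ─ 6) (c₄ 1 5 4 6) (p₆ 1 3 0 2 4 6))
           (p₆ 1 3 0 2 4 5))
          (p₆ 4 2 0 3 1 6))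
         (p₆ 4 2 0 3 1 5))))))
    -- One edge of each colour: the red edge is extended at one end and, if that reply is red, at
    -- the other, which threatens a red cycle.
    (draw (0 ─ 4)
     (draw (1 ─ 5)
      (draw (4 ─ 5) (c₄ 0 1 5 4)
       (draw (0 ─ 6)
        (draw (5 ─ 6) (c₄ 0 1 5 6)
         (draw (2 ─ 4)
          (draw (2 ─ 6) (c₄ 0 4 2 6)
           (draw (1 ─ 6)
            (draw (1 ─ 4) (c₄ 0 4 1 6) (p₆ 1 4 5 6 2 3))
            (draw (1 ─ 2) (c₄ 0 1 2 4) (p₆ 3 2 1 6 5 4))))
          (draw (0 ─ 3)
           (draw (1 ─ 3)
            (draw (1 ─ 6) (c₄ 0 3 1 6) (p₆ 1 6 5 4 2 3))
            (p₆ 1 3 2 4 5 6))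
           (p₆ 0 3 2 4 5 6))))
        (draw (2 ─ 4)
         (draw (1 ─ 2) (c₄ 0 1 2 4)
          (draw (2 ─ 5)
           (draw (0 ─ 2) (c₄ 0 1 5 2) (draw (1 ─ 4) (c₄ 1 4 2 5) (p₆ 5 4 1 2 0 6)))
           (draw (1 ─ 6)
            (draw (4 ─ 6) (c₄ 0 1 6 4) (p₆ 0 6 4 5 2 1))
            (p₆ 0 6 1 2 5 4))))
         (draw (3 ─ 6)
          (draw (0 ─ 3)
           (draw (0 ─ 5)
            (draw (5 ─ 6) (c₄ 0 3 6 5) (p₆ 0 6 5 4 2 3))
            (p₆ 3 2 4 5 0 6))
           (p₆ 5 4 2 3 0 6))
          (p₆ 0 6 3 2 4 5)))))
      (draw (2 ─ 4)
       (draw (1 ─ 2) (c₄ 0 1 2 4)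
        (draw (0 ─ 5)
         (draw (3 ─ 6)
          (draw (0 ─ 3)
           (draw (4 ─ 6) (c₄ 0 3 6 4) (draw (5 ─ 6) (c₄ 0 3 6 5) (p₆ 3 2 1 5 6 4)))
           (draw (1 ─ 4)
            (draw (4 ─ 5) (c₄ 0 1 4 5) (p₆ 0 3 2 1 5 4))
            (draw (2 ─ 5) (c₄ 0 4 2 5) (p₆ 0 3 2 5 1 4))))
          (draw (6 ─ 7)
           (draw (0 ─ 6)
            (draw (5 ─ 7) (c₄ 0 5 7 6) (p₆ 6 3 2 1 5 7))
            (p₆ 0 6 3 2 1 5))
           (p₆ 5 1 2 3 6 7)))
         (draw (3 ─ 4)
          (draw (0 ─ 6)
           (draw (3 ─ 6) (c₄ 0 4 3 6) (p₆ 0 5 1 2 3 6))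
           (p₆ 3 2 1 5 0 6))
          (p₆ 0 5 1 2 3 4))))
       (draw (4 ─ 6)
        (draw (1 ─ 6) (c₄ 0 1 6 4)
         (draw (3 ─ 5)
          (draw (3 ─ 6)
           (draw (4 ─ 5) (c₄ 3 5 4 6) (p₆ 3 2 4 5 1 6))
           (p₆ 4 2 3 6 1 5))
          (p₆ 4 2 3 5 1 6)))
        (draw (1 ─ 3)
         (draw (1 ─ 6)
          (draw (5 ─ 6)
           (draw (3 ─ 5) (c₄ 1 3 5 6) (p₆ 1 5 3 2 4 6))
           (p₆ 1 5 6 4 2 3))
          (p₆ 3 2 4 6 1 5))
         (p₆ 5 1 3 2 4 6)))))
     (draw (0 ─ 2)
      (draw (1 ─ 4)
       (draw (2 ─ 4) (c₄ 0 1 4 2)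
        (draw (1 ─ 5)
         (draw (2 ─ 5) (c₄ 0 1 5 2)
          (draw (0 ─ 6)
           (draw (4 ─ 6) (c₄ 0 1 4 6) (draw (5 ─ 6) (c₄ 0 1 5 6) (p₆ 0 4 6 5 2 3)))
           (draw (3 ─ 4)
            (draw (3 ─ 5) (c₄ 1 4 3 5) (p₆ 3 5 2 4 0 6))
            (p₆ 5 2 3 4 0 6))))
         (draw (0 ─ 5)
          (draw (1 ─ 3)
           (draw (3 ─ 5) (c₄ 0 1 3 5) (p₆ 0 4 2 3 5 1))
           (p₆ 0 4 2 3 1 5))
          (p₆ 1 5 0 4 2 3))))
       (draw (1 ─ 5)
        (draw (2 ─ 5) (c₄ 0 1 5 2)
         (draw (0 ─ 5)
          (draw (0 ─ 3)
           (draw (1 ─ 3) (c₄ 0 3 1 5) (p₆ 0 4 1 3 2 5))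
           (p₆ 1 4 0 3 2 5))
          (p₆ 1 4 0 5 2 3)))
        (draw (2 ─ 5)
         (draw (3 ─ 5)
          (draw (0 ─ 3) (c₄ 0 2 5 3) (p₆ 2 3 0 4 1 5))
          (p₆ 0 4 1 5 3 2))
         (p₆ 0 4 1 5 2 3))))
      (draw (1 ─ 3)
       (draw (3 ─ 5)
        (draw (0 ─ 5) (c₄ 0 1 3 5)
         (draw (1 ─ 4)
          (draw (4 ─ 5) (c₄ 1 3 5 4)
           (draw (3 ─ 6)
            (draw (4 ─ 6) (c₄ 1 3 6 4) (p₆ 3 2 0 5 4 6))
            (p₆ 4 5 0 2 3 6)))
          (draw (2 ─ 5)
           (draw (1 ─ 2) (c₄ 1 2 5 3) (p₆ 3 2 1 4 0 5))
           (p₆ 1 4 0 5 2 3))))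
        (draw (1 ─ 4)
         (draw (4 ─ 6)
          (draw (5 ─ 6)
           (draw (1 ─ 5) (c₄ 1 4 6 5) (p₆ 1 5 3 2 0 4))
           (p₆ 4 0 2 3 5 6))
          (p₆ 5 3 2 0 4 6))
         (p₆ 1 4 0 2 3 5)))
       (draw (4 ─ 5)
        (draw (1 ─ 6)
         (draw (1 ─ 5)
          (draw (4 ─ 6) (c₄ 1 5 4 6) (p₆ 1 3 2 0 4 6))
          (p₆ 4 0 2 3 1 5))
         (p₆ 4 0 2 3 1 6))
        (p₆ 1 3 2 0 4 5))))))
   (draw (2 ─ 3)
    -- The same position as with `0 ─ 1` red and `2 ─ 3` blue, with the two edges interchanged.
    (draw (2 ─ 4)
     (draw (3 ─ 5)
      (draw (4 ─ 5) (c₄ 2 3 5 4)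
       (draw (2 ─ 6)
        (draw (5 ─ 6) (c₄ 2 3 5 6)
         (draw (0 ─ 4)
          (draw (0 ─ 6) (c₄ 0 4 2 6)
           (draw (1 ─ 4)
            (draw (1 ─ 3) (c₄ 1 3 2 4) (p₆ 3 1 0 6 5 4))
            (draw (0 ─ 3) (c₄ 0 3 2 4) (p₆ 1 4 5 6 0 3))))
          (draw (1 ─ 2)
           (draw (1 ─ 3)
            (draw (3 ─ 6) (c₄ 1 2 6 3) (p₆ 1 0 4 5 6 3))
            (p₆ 3 1 0 4 5 6))
           (p₆ 2 1 0 4 5 6))))
        (draw (0 ─ 4)
         (draw (0 ─ 3) (c₄ 0 3 2 4)
          (draw (0 ─ 5)
           (draw (0 ─ 2) (c₄ 0 2 3 5) (draw (3 ─ 4) (c₄ 0 4 3 5) (p₆ 5 4 3 0 2 6)))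
           (draw (3 ─ 6)
            (draw (4 ─ 6) (c₄ 2 3 6 4) (p₆ 1 0 5 4 6 2))
            (p₆ 2 6 3 0 5 4))))
         (draw (1 ─ 6)
          (draw (1 ─ 2)
           (draw (1 ─ 5) (c₄ 1 2 3 5) (draw (4 ─ 6) (c₄ 1 2 4 6) (p₆ 0 1 5 4 6 2)))
           (p₆ 5 4 0 1 2 6))
          (p₆ 2 6 1 0 4 5)))))
      (draw (0 ─ 4)
       (draw (0 ─ 3) (c₄ 0 3 2 4)
        (draw (1 ─ 4)
         (draw (5 ─ 6)
          (draw (4 ─ 5)
           (draw (1 ─ 6) (c₄ 1 4 5 6) (draw (2 ─ 6) (c₄ 2 4 5 6) (p₆ 2 6 1 0 3 5)))
           (draw (0 ─ 2)
            (draw (1 ─ 2) (c₄ 0 2 1 4) (p₆ 2 1 0 3 5 4))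
            (draw (1 ─ 3) (c₄ 1 3 2 4) (p₆ 2 0 1 3 5 4))))
          (draw (6 ─ 7)
           (draw (1 ─ 7)
            (draw (4 ─ 6) (c₄ 1 4 6 7) (p₆ 1 0 3 5 6 4))
            (p₆ 6 5 3 0 1 7))
           (p₆ 1 0 3 5 6 7)))
         (draw (2 ─ 5)
          (draw (4 ─ 6)
           (draw (5 ─ 6) (c₄ 2 4 6 5) (p₆ 4 1 0 3 5 6))
           (p₆ 5 3 0 1 4 6))
          (p₆ 2 5 3 0 1 4))))
       (draw (4 ─ 6)
        (draw (3 ─ 6) (c₄ 2 3 6 4)
         (draw (1 ─ 5)
          (draw (1 ─ 6)
           (draw (4 ─ 5) (c₄ 1 5 4 6) (p₆ 1 0 4 5 3 6))
           (p₆ 4 0 1 6 3 5))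
          (p₆ 4 0 1 5 3 6)))
        (draw (1 ─ 3)
         (draw (3 ─ 6)
          (draw (5 ─ 6)
           (draw (1 ─ 5) (c₄ 1 3 6 5) (p₆ 3 5 1 0 4 6))
           (p₆ 1 0 4 6 5 3))
          (p₆ 1 0 4 6 3 5))
         (p₆ 5 3 1 0 4 6)))))
     (draw (0 ─ 2)
      (draw (3 ─ 4)
       (draw (0 ─ 4) (c₄ 0 2 3 4)
        (draw (3 ─ 5)
         (draw (0 ─ 5) (c₄ 0 2 3 5)
          (draw (2 ─ 6)
           (draw (4 ─ 6) (c₄ 2 3 4 6) (draw (5 ─ 6) (c₄ 2 3 5 6) (p₆ 1 0 5 6 4 2)))
           (draw (1 ─ 4)
            (draw (1 ─ 5) (c₄ 1 4 3 5) (p₆ 1 5 0 4 2 6))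
            (p₆ 5 0 1 4 2 6))))
         (draw (1 ─ 3)
          (draw (1 ─ 5)
           (draw (2 ─ 5) (c₄ 1 3 2 5) (p₆ 1 0 4 2 5 3))
           (p₆ 2 4 0 1 5 3))
          (p₆ 2 4 0 1 3 5))))
       (draw (0 ─ 5)
        (draw (3 ─ 5) (c₄ 0 2 3 5)
         (draw (1 ─ 5)
          (draw (1 ─ 2) (c₄ 0 2 1 5) (p₆ 0 1 2 4 3 5))
          (p₆ 0 1 5 3 4 2)))
        (draw (1 ─ 3)
         (draw (1 ─ 2)
          (draw (2 ─ 5)
           (draw (3 ─ 5) (c₄ 1 2 5 3) (p₆ 1 0 5 3 4 2))
           (p₆ 1 0 5 2 4 3))
          (p₆ 3 4 2 1 0 5))
         (p₆ 2 4 3 1 0 5))))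
      (draw (1 ─ 3)
       (draw (1 ─ 5)
        (draw (2 ─ 5) (c₄ 1 3 2 5)
         (draw (3 ─ 4)
          (draw (4 ─ 5) (c₄ 1 3 4 5)
           (draw (1 ─ 6)
            (draw (4 ─ 6) (c₄ 1 3 4 6) (p₆ 1 0 2 5 4 6))
            (p₆ 4 5 2 0 1 6)))
          (draw (0 ─ 5)
           (draw (0 ─ 3) (c₄ 0 3 1 5) (p₆ 1 0 3 4 2 5))
           (p₆ 1 0 5 2 4 3))))
        (draw (3 ─ 4)
         (draw (4 ─ 6)
          (draw (5 ─ 6)
           (draw (3 ─ 5) (c₄ 3 4 6 5) (p₆ 3 5 1 0 2 4))
           (p₆ 4 2 0 1 5 6))
          (p₆ 5 1 0 2 4 6))
         (p₆ 3 4 2 0 1 5)))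
       (draw (4 ─ 5)
        (draw (3 ─ 6)
         (draw (3 ─ 5)
          (draw (4 ─ 6) (c₄ 3 5 4 6) (p₆ 3 1 0 2 4 6))
          (p₆ 4 2 0 1 3 5))
         (p₆ 4 2 0 1 3 6))
        (p₆ 3 1 0 2 4 5)))))
    -- Both edges blue: a blue reply joins them into a blue path with three edges.
    (draw (0 ─ 2)
     (draw (0 ─ 4)
      (draw (1 ─ 4)
       (draw (1 ─ 2) (c₄ 0 2 1 4)
        (draw (4 ─ 5)
         (draw (2 ─ 5) (c₄ 0 2 5 4)
          (draw (0 ─ 6)
           (draw (1 ─ 6) (c₄ 0 4 1 6) (draw (5 ─ 6) (c₄ 0 4 5 6) (p₆ 0 1 6 5 2 3)))
           (draw (1 ─ 3)
            (draw (3 ─ 5) (c₄ 1 3 5 4) (p₆ 3 5 2 1 0 6))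
            (p₆ 5 2 3 1 0 6))))
         (draw (0 ─ 5)
          (draw (3 ─ 4)
           (draw (3 ─ 5) (c₄ 0 4 3 5) (p₆ 0 1 2 3 5 4))
           (p₆ 0 1 2 3 4 5))
          (p₆ 3 2 1 0 5 4))))
       (draw (2 ─ 5)
        (draw (4 ─ 5) (c₄ 0 2 5 4)
         (draw (3 ─ 5)
          (draw (0 ─ 3) (c₄ 0 2 5 3) (p₆ 2 3 0 1 4 5))
          (p₆ 0 1 4 5 3 2)))
        (draw (3 ─ 4)
         (draw (0 ─ 3)
          (draw (0 ─ 5)
           (draw (4 ─ 5) (c₄ 0 3 4 5) (p₆ 0 1 4 5 2 3))
           (p₆ 3 2 5 0 1 4))
          (p₆ 4 1 0 3 2 5))
         (p₆ 0 1 4 3 2 5))))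
      (draw (1 ─ 3)
       (draw (3 ─ 4)
        (draw (1 ─ 5)
         (draw (4 ─ 5) (c₄ 1 3 4 5)
          (draw (3 ─ 5)
           (draw (1 ─ 2)
            (draw (2 ─ 5) (c₄ 1 2 5 3) (p₆ 1 0 4 5 2 3))
            (p₆ 3 2 1 0 4 5))
           (p₆ 1 0 4 5 3 2)))
         (draw (2 ─ 5)
          (draw (2 ─ 4)
           (draw (3 ─ 5) (c₄ 2 4 3 5) (p₆ 2 3 5 1 0 4))
           (p₆ 3 2 4 0 1 5))
          (p₆ 3 2 5 1 0 4)))
        (draw (1 ─ 5)
         (draw (2 ─ 6)
          (draw (1 ─ 6)
           (draw (2 ─ 5) (c₄ 1 5 2 6) (p₆ 1 0 4 3 2 5))
           (p₆ 2 3 4 0 1 6))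
          (p₆ 1 0 4 3 2 6))
         (p₆ 2 3 4 0 1 5)))
       (draw (4 ─ 5)
        (draw (2 ─ 6)
         (draw (2 ─ 5)
          (draw (4 ─ 6) (c₄ 2 5 4 6) (p₆ 2 3 1 0 4 6))
          (p₆ 4 0 1 3 2 5))
         (p₆ 4 0 1 3 2 6))
        (p₆ 2 3 1 0 4 5))))
     (draw (1 ─ 4)
      (draw (1 ─ 5)
       (draw (4 ─ 6)
        (draw (5 ─ 6) (c₄ 1 4 6 5)
         (draw (1 ─ 6)
          (draw (3 ─ 6)
           (draw (3 ─ 5) (c₄ 1 5 3 6) (p₆ 1 0 2 3 5 6))
           (p₆ 1 0 2 3 6 5))
          (p₆ 3 2 0 1 6 5)))
        (draw (3 ─ 4)
         (draw (3 ─ 6)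
          (draw (1 ─ 6) (c₄ 1 4 3 6) (p₆ 3 2 0 1 6 4))
          (p₆ 1 0 2 3 6 4))
         (p₆ 1 0 2 3 4 6)))
       (draw (4 ─ 5)
        (draw (5 ─ 6)
         (draw (3 ─ 4)
          (draw (3 ─ 6) (c₄ 3 4 5 6) (p₆ 5 1 0 2 3 6))
          (p₆ 4 3 2 0 1 5))
         (p₆ 3 2 0 1 5 6))
        (p₆ 3 2 0 1 5 4)))
      (draw (3 ─ 5)
       (draw (3 ─ 6)
        (draw (4 ─ 5)
         (draw (4 ─ 6) (c₄ 3 5 4 6) (p₆ 3 2 0 1 4 6))
         (p₆ 3 2 0 1 4 5))
        (p₆ 4 1 0 2 3 6))
       (p₆ 4 1 0 2 3 5)))))

-- One evaluation checks that every edge is fresh when drawn and that every leaf holds the copy it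
-- claims.
strategy-winning : Winning strategy []
strategy-winning = toWitness {a? = winning? (cycleAdj? 4) (pathAdj? 6) strategy []} tt

theorem2 : r̃⟨ cycle 4 , path 6 ⟩≡ 11
-- `rounds strategy`, the depth of the tree, evaluates to 11.
theorem2 = follow-wins strategy strategy-winning , lowerBound
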